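{- Let $s\ge0$ be an integer with $s\ne1$, let $h\in\mathbb C\setminus\{0\}$, and let $q\in\mathbb C\setminus\{0\}$ be either $1$ or not a root of unity. Let $n\ge1$ and let $\mathbf r=(r_1,\ldots,r_n)$, $\mathbf s=(s_1,\ldots,s_n)$ be sequences of nonnegative integers. Then for every integer $k\ge0$, $$S^{\mathbf r,\mathbf s}_{s,h,q}[k]=\frac{h^{|\mathbf s|-k}}{[k]_{q,1-s}!}\sum_{j=0}^k(-1)^{k-j}q^{\binom{k-j}2(1-s)}\genfrac{[}{]}{0pt}{}{k}{j}_{q^{1-s}}\Omega^{\mathbf r,\mathbf s}_{s,q}[j],$$ where $$\Omega^{\mathbf r,\mathbf s}_{s,q}[j]=\prod_{t=1}^n\bigl[\,j-(s_1+\cdots+s_{t-1})+(r_1+\cdots+r_{t-1})/(1-s)\,\bigr]^{(\underline{s_t})}_{q,1-s}.$$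
   Context: For an integer $x$, $[x]_q=\frac{q^x-1}{q-1}$ if $q\ne1$ and $[x]_1=x$. For $r\in\mathbb R$ and an integer $j\ge0$, $[r]^{(\underline j)}_{q,1-s}=[r(1-s)]_q[(r-1)(1-s)]_q\cdots[(r-j+1)(1-s)]_q$ (in the statement all the numbers $(r-i)(1-s)$ that occur are integers), and $[n]_{q,1-s}!=[n]^{(\underline n)}_{q,1-s}$. $\genfrac{[}{]}{0pt}{}{k}{j}_p$ is the Gaussian ($p$-binomial) coefficient. $|\cdot|$ denotes the sum of the entries of a finite sequence. The numbers $S^{\mathbf r,\mathbf s}_{s,h,q}[k]$ are the normal ordering coefficients of $H_{\mathbf r,\mathbf s}=V^{r_n}U^{s_n}\cdots V^{r_2}U^{s_2}V^{r_1}U^{s_1}$ where $UV-qVU=hV^s$: in the algebra $\mathbb C\langle U,V\rangle/(UV-qVU-hV^s)$ (in which the monomials $V^iU^j$, $i,j\ge0$, form a basis), $H_{\mathbf r,\mathbf s}=\sum_{k=s_1}^{|\mathbf s|}S^{\mathbf r,\mathbf s}_{s,h,q}[k]\,V^{|\mathbf r|-(|\mathbf s|-k)(1-s)}U^k$, the coefficient being taken as $0$ when the exponent of $V$ is negative, and $S^{\mathbf r,\mathbf s}_{s,h,q}[k]=0$ when $k<s_1$ or $k>|\mathbf s|$. -}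

module Defs where

open import Level using (_⊔_)
open import Algebra.Bundles using (CommutativeRing; Ring; Semiring)
open import Algebra.Apartness.Bundles using (HeytingField)
import Algebra.Apartness.Properties.HeytingCommutativeRing as HeytingProperties
import Algebra.Definitions.RawSemiring as RawSemiringDefinitions
import Algebra.Properties.CommutativeSemiring.Exp as ExpProperties
import Algebra.Properties.Monoid.Sum as MonoidSum
import Algebra.Properties.Ring as RingProperties
open import Data.Fin.Base using (Fin; zero; suc; toℕ)
open import Data.Fin.Properties using (toℕ<n)
open import Data.Integer.Base as ℤ using (ℤ; +_; +[1+_]; -[1+_]; 0ℤ; 1ℤ)
import Data.Integer.DivMod as ℤ
import Data.Integer.Properties as ℤ
import Data.List.Base as List
open import Data.Nat.Base as ℕ using (ℕ; zero; suc; _∸_)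
import Data.Nat.Properties as ℕ
open import Data.Product.Base using (_×_; _,_; proj₁; proj₂)
open import Data.Rational.Unnormalised.Base as ℚ using (ℚᵘ; floor)
open import Data.Sum.Base using (_⊎_; inj₁; inj₂)
open import Data.Vec.Base as Vec using (Vec; []; _∷_)
open import Relation.Binary.PropositionalEquality.Core as ≡ using (_≡_; _≢_)
open import Relation.Nullary.Negation using (contradiction)
import Relation.Binary.Reasoning.Setoid as SetoidReasoning

fromℤ : ℤ → ℚᵘ
fromℤ z = z ℚ./ 1

1-_ : ℕ → ℤ
1- s = 1ℤ ℤ.- + s

1-s≢0 : ∀ {s} → s ≢ 1 → 1- s ≢ 0ℤ
1-s≢0 s≢1 eq = s≢1 (≡.sym (ℤ.+-injective (ℤ.i-j≡0⇒i≡j 1ℤ (+ _) eq)))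

partialSum : ∀ {n} → Vec ℕ n → ℕ → ℕ
partialSum v t = List.sum (List.take t (Vec.toList v))

exponentV : ∀ {n} → ℕ → Vec ℕ n → Vec ℕ n → ℕ → ℤ
exponentV s rs ss k = + Vec.sum rs ℤ.- (+ Vec.sum ss ℤ.- + k) ℤ.* (1- s)

floor-fromℤ : ∀ a b d → floor ((fromℤ a ℚ.- fromℤ b) ℚ.* fromℤ d) ≡ (a ℤ.- b) ℤ.* d
floor-fromℤ a b d =
  ≡.trans (z/1≡z _) (≡.cong (ℤ._* d) (≡.cong₂ ℤ._+_ (ℤ.*-identityʳ a) (ℤ.*-identityʳ (ℤ.- b))))
  where
  z%1≡0 : ∀ z → z ℤ.% 1ℤ ≡ 0
  z%1≡0 z = ℕ.n<1⇒n≡0 (ℤ.n%d<d z 1ℤ)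

  z/1≡z : ∀ z → z ℤ./ 1ℤ ≡ z
  z/1≡z z = ≡.sym (≡.trans (ℤ.a≡a%n+[a/n]*n z 1ℤ)
    (≡.trans (≡.cong₂ ℤ._+_ (≡.cong +_ (z%1≡0 z)) (ℤ.*-identityʳ (z ℤ./ 1ℤ)))
             (ℤ.+-identityˡ (z ℤ./ 1ℤ))))

-- K stands for ℂ, or more generally any field of characteristic zero; x # y is
-- the constructive form of x ≠ y, and agrees with it classically.
module OverField {c ℓ₁ ℓ₂} (K : HeytingField c ℓ₁ ℓ₂) where
  open HeytingField K hiding (zero)
  open HeytingProperties heytingCommutativeRing

  commutativeRing : CommutativeRing c ℓ₁
  commutativeRing = record { isCommutativeRing = isCommutativeRing }

  open CommutativeRing commutativeRing using (ring; semiring; commutativeSemiring; +-monoid)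
  open RingProperties ring using (-‿involutive; -‿distribʳ-*; [y-z]x≈yx-zx)
  open ExpProperties commutativeSemiring using (^-congˡ; ^-assocʳ; ^-distrib-*)
  open RawSemiringDefinitions (Semiring.rawSemiring semiring) public using (_^_; product) renaming (_×_ to _·_)
  open MonoidSum +-monoid public using (sum-syntax)

  CharacteristicZero : Set ℓ₂
  CharacteristicZero = ∀ n → suc n · 1# # 0#

  NotRootOfUnity : Carrier → Set ℓ₂
  NotRootOfUnity q = ∀ n → q ^ suc n # 1#

  Admissible : Carrier → Set (ℓ₁ ⊔ ℓ₂)
  Admissible q = q # 0# × (q ≈ 1# ⊎ NotRootOfUnity q)

  inv : ∀ {x} → x # 0# → Carrier
  inv x#0 = proj₁ (#⇒invertible x#0)

  inv-inverseʳ : ∀ {x} (x#0 : x # 0#) → x * inv x#0 ≈ 1#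
  inv-inverseʳ {x} x#0 =
    trans (*-congʳ (sym (x-0≈x x))) (proj₂ (proj₂ (#⇒invertible x#0)))

  inverse⇒#0 : ∀ {x y} → x * y ≈ 1# → x # 0#
  inverse⇒#0 {x} {y} xy≈1 = invertibleʳ⇒# (y , trans (*-congʳ (x-0≈x x)) xy≈1)

  inv#0 : ∀ {x} (x#0 : x # 0#) → inv x#0 # 0#
  inv#0 x#0 = inverse⇒#0 (trans (*-comm _ _) (inv-inverseʳ x#0))

  #⇒-#0 : ∀ {x y} → x # y → x - y # 0#
  #⇒-#0 x#y = inverse⇒#0 (proj₂ (proj₂ (#⇒invertible x#y)))

  pow : ∀ x → x # 0# → ℤ → Carrier
  pow x x#0 (+ n)    = x ^ n
  pow x x#0 -[1+ n ] = inv x#0 ^ suc n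

  fromInteger : ℤ → Carrier
  fromInteger (+ n)    = n · 1#
  fromInteger -[1+ n ] = - (suc n · 1#)

  qNumber : ∀ {q} → Admissible q → ℤ → Carrier
  qNumber     (q#0 , inj₁ q≈1)      x = fromInteger x
  qNumber {q} (q#0 , inj₂ nonroot) x = (pow q q#0 x - 1#) * inv q-1#0
    where
    q-1#0 : q - 1# # 0#
    q-1#0 = #⇒-#0 (#-congʳ (*-identityʳ q) (nonroot 0))

  -- [r d][(r - 1) d] ⋯ [(r - j + 1) d], for rational r such that all the
  -- numbers (r - i) d are integers; floor only serves to read them as such.
  falling : ∀ {q} → Admissible q → ℤ → ℚᵘ → ℕ → Carrier
  falling q d r j =
    product {j} λ i → qNumber q (floor ((r ℚ.- fromℤ (+ toℕ i)) ℚ.* fromℤ d))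

  factorial : ∀ {q} → Admissible q → ℤ → ℕ → Carrier
  factorial q d n = falling q d (fromℤ (+ n)) n

  product#0 : ∀ {n} (f : Fin n → Carrier) → (∀ i → f i # 0#) → product f # 0#
  product#0 {zero}  f f#0 = 1#0
  product#0 {suc n} f f#0 = x#0y#0→xy#0 (f#0 zero) (product#0 (λ i → f (suc i)) (λ i → f#0 (suc i)))

  ^#0 : ∀ {x} n → x # 0# → x ^ n # 0#
  ^#0 zero    x#0 = 1#0
  ^#0 (suc n) x#0 = x#0y#0→xy#0 x#0 (^#0 n x#0)

  pow#0 : ∀ {x} (x#0 : x # 0#) z → pow x x#0 z # 0#
  pow#0 x#0 (+ n)    = ^#0 n x#0
  pow#0 x#0 -[1+ n ] = ^#0 (suc n) (inv#0 x#0)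

  1^n≈1 : ∀ n → 1# ^ n ≈ 1#
  1^n≈1 zero    = refl
  1^n≈1 (suc n) = trans (*-identityˡ _) (1^n≈1 n)

  -x#0 : ∀ {x} → x # 0# → - x # 0#
  -x#0 {x} x#0 = inverse⇒#0 {y = - inv x#0} (begin
    - x * - inv x#0     ≈⟨ -‿distribʳ-* (- x) (inv x#0) ⟨
    - (- x * inv x#0)   ≈⟨ -‿cong (*-comm _ _) ⟩
    - (inv x#0 * - x)   ≈⟨ -‿cong (-‿distribʳ-* (inv x#0) x) ⟨
    - - (inv x#0 * x)   ≈⟨ -‿involutive _ ⟩
    inv x#0 * x         ≈⟨ *-comm _ _ ⟩
    x * inv x#0         ≈⟨ inv-inverseʳ x#0 ⟩
    1#                  ∎)
    where open SetoidReasoning setoid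

  inv-^#1 : ∀ {x} (x#0 : x # 0#) n → x ^ n # 1# → inv x#0 ^ n # 1#
  inv-^#1 {x} x#0 n xⁿ#1 = #-sym (#-congˡ (*-identityˡ _)
      (#-congʳ xⁿyⁿ≈1 (*-cancel# (^#0 n (inv#0 x#0)) xⁿ#1)))
    where
    xⁿyⁿ≈1 : x ^ n * inv x#0 ^ n ≈ 1#
    xⁿyⁿ≈1 = trans (sym (^-distrib-* x (inv x#0) n))
                   (trans (^-congˡ n (inv-inverseʳ x#0)) (1^n≈1 n))

    *-cancel# : ∀ {a b y} → y # 0# → a # b → a * y # b * y
    *-cancel# {a} {b} {y} y#0 a#b =
      invertibleʳ⇒# (proj₁ i , trans (*-congʳ eq) (proj₂ (proj₂ i)))
      where
      i = #⇒invertible (x#0y#0→xy#0 (#⇒-#0 a#b) y#0)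
      eq : a * y - b * y ≈ (a - b) * y - 0#
      eq = sym (trans (x-0≈x _) ([y-z]x≈yx-zx y a b))

  pow-nonroot : ∀ {q} (q#0 : q # 0#) → NotRootOfUnity q → ∀ d .{{_ : ℤ.NonZero d}} → NotRootOfUnity (pow q q#0 d)
  pow-nonroot {q} q#0 nonroot +[1+ m ] n =
    #-congʳ (sym (^-assocʳ q (suc m) (suc n))) (nonroot (n ℕ.+ m ℕ.* suc n))
  pow-nonroot {q} q#0 nonroot -[1+ m ] n =
    #-congʳ (sym (^-assocʳ (inv q#0) (suc m) (suc n))) (inv-^#1 q#0 (suc m ℕ.* suc n) (nonroot (n ℕ.+ m ℕ.* suc n)))

  pow-one : ∀ {q} (q#0 : q # 0#) → q ≈ 1# → ∀ d → pow q q#0 d ≈ 1#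
  pow-one q#0 q≈1 (+ n)    = trans (^-congˡ n q≈1) (1^n≈1 n)
  pow-one {q} q#0 q≈1 -[1+ n ] = trans (^-congˡ (suc n) inv≈1) (1^n≈1 (suc n))
    where
    inv≈1 : inv q#0 ≈ 1#
    inv≈1 = trans (sym (*-identityˡ _)) (trans (*-congʳ (sym q≈1)) (inv-inverseʳ q#0))

  pow-admissible : ∀ {q} ((q#0 , _) : Admissible q) d .{{_ : ℤ.NonZero d}} → Admissible (pow q q#0 d)
  pow-admissible (q#0 , inj₁ q≈1)     d = pow#0 q#0 d , inj₁ (pow-one q#0 q≈1 d)
  pow-admissible (q#0 , inj₂ nonroot) d = pow#0 q#0 d , inj₂ (pow-nonroot q#0 nonroot d)

  module _ (char0 : CharacteristicZero) where

    qNumber#0 : ∀ {q} (adm : Admissible q) x → x ≢ 0ℤ → qNumber adm x # 0#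
    qNumber#0 (q#0 , inj₁ q≈1) (+ zero)  x≢0 = contradiction ≡.refl x≢0
    qNumber#0 (q#0 , inj₁ q≈1) +[1+ n ]  x≢0 = char0 n
    qNumber#0 (q#0 , inj₁ q≈1) -[1+ n ]  x≢0 = -x#0 (char0 n)
    qNumber#0 (q#0 , inj₂ nonroot) (+ zero) x≢0 = contradiction ≡.refl x≢0
    qNumber#0 (q#0 , inj₂ nonroot) +[1+ n ] x≢0 =
      x#0y#0→xy#0 (#⇒-#0 (nonroot n)) (inv#0 _)
    qNumber#0 (q#0 , inj₂ nonroot) -[1+ n ] x≢0 =
      x#0y#0→xy#0 (#⇒-#0 (inv-^#1 q#0 (suc n) (nonroot n))) (inv#0 _)

    factorial#0 : ∀ {q} (adm : Admissible q) d .{{_ : ℤ.NonZero d}} n → factorial adm d n # 0#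
    factorial#0 adm d n = product#0 {n} _ λ i → qNumber#0 adm _ (factor≢0 i)
      where
      factor≢0 : ∀ (i : Fin n) → floor ((fromℤ (+ n) ℚ.- fromℤ (+ toℕ i)) ℚ.* fromℤ d) ≢ 0ℤ
      factor≢0 i eq with ℤ.i*j≡0⇒i≡0∨j≡0 (+ n ℤ.- + toℕ i) (≡.trans (≡.sym (floor-fromℤ (+ n) (+ toℕ i) d)) eq)
      ... | inj₁ n-i≡0 = ℕ.<⇒≢ (toℕ<n i) (≡.sym (ℤ.+-injective (ℤ.i-j≡0⇒i≡j (+ n) (+ toℕ i) n-i≡0)))
      ... | inj₂ d≡0   = ℕ.≢-nonZero⁻¹ ℤ.∣ d ∣ (≡.cong ℤ.∣_∣ d≡0)

    -- [k]! / ([j]! [k - j]!)  in base p.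
    gaussian : ∀ {p} → Admissible p → (k : ℕ) → Fin (suc k) → Carrier
    gaussian p k j =
      factorial p 1ℤ k *
      inv {factorial p 1ℤ (toℕ j) * factorial p 1ℤ (k ∸ toℕ j)}
        (x#0y#0→xy#0 (factorial#0 p 1ℤ (toℕ j)) (factorial#0 p 1ℤ (k ∸ toℕ j)))

  Ω : ∀ {q n} → Admissible q → (s : ℕ) .{{_ : ℤ.NonZero (1- s)}} → Vec ℕ n → Vec ℕ n → ℕ → Carrier
  Ω {n = n} q s rs ss j = product {n} λ t →
    falling q (1- s)
      (fromℤ (+ j) ℚ.- fromℤ (+ partialSum ss (toℕ t))
        ℚ.+ fromℤ (+ partialSum rs (toℕ t)) ℚ.÷ fromℤ (1- s))
      (Vec.lookup ss t)

  infixl 6 _⊕_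
  infixl 7 _⊗_
  infix  8 ⊖_
  infixr 8 _^ᵀ_

  data Term : Set c where
    ι       : Carrier → Term
    U V     : Term
    _⊕_ _⊗_ : Term → Term → Term
    ⊖_      : Term → Term

  _^ᵀ_ : Term → ℕ → Term
  x ^ᵀ zero  = ι 1#
  x ^ᵀ suc n = x ⊗ x ^ᵀ n

  module Algebra (s : ℕ) (h q : Carrier) where

    infix 4 _≋_

    -- The least K-algebra congruence on terms containing U V - q V U = h V ^ s:
    -- terms up to _≋_ form the algebra K⟨U, V⟩ / (U V - q V U - h V ^ s).
    data _≋_ : Term → Term → Set (c ⊔ ℓ₁) where
      relation : U ⊗ V ⊕ ⊖ (ι q ⊗ (V ⊗ U)) ≋ ι h ⊗ V ^ᵀ s

      ι-cong    : ∀ {a b} → a ≈ b → ι a ≋ ι b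
      ι-+       : ∀ a b → ι (a + b) ≋ ι a ⊕ ι b
      ι-*       : ∀ a b → ι (a * b) ≋ ι a ⊗ ι b
      ι-central : ∀ a x → ι a ⊗ x ≋ x ⊗ ι a

      ≋-refl  : ∀ {x} → x ≋ x
      ≋-sym   : ∀ {x y} → x ≋ y → y ≋ x
      ≋-trans : ∀ {x y z} → x ≋ y → y ≋ z → x ≋ z
      ⊕-cong  : ∀ {x y u v} → x ≋ y → u ≋ v → x ⊕ u ≋ y ⊕ v
      ⊗-cong  : ∀ {x y u v} → x ≋ y → u ≋ v → x ⊗ u ≋ y ⊗ v
      ⊖-cong  : ∀ {x y} → x ≋ y → ⊖ x ≋ ⊖ y

      ⊕-assoc     : ∀ x y z → (x ⊕ y) ⊕ z ≋ x ⊕ (y ⊕ z)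
      ⊕-comm      : ∀ x y → x ⊕ y ≋ y ⊕ x
      ⊕-identityˡ : ∀ x → ι 0# ⊕ x ≋ x
      ⊕-inverseˡ  : ∀ x → ⊖ x ⊕ x ≋ ι 0#
      ⊗-assoc     : ∀ x y z → (x ⊗ y) ⊗ z ≋ x ⊗ (y ⊗ z)
      ⊗-identityˡ : ∀ x → ι 1# ⊗ x ≋ x
      ⊗-identityʳ : ∀ x → x ⊗ ι 1# ≋ x
      ⊗-distribˡ-⊕ : ∀ x y z → x ⊗ (y ⊕ z) ≋ x ⊗ y ⊕ x ⊗ z
      ⊗-distribʳ-⊕ : ∀ x y z → (y ⊕ z) ⊗ x ≋ y ⊗ x ⊕ z ⊗ x

    algebra : Ring c (c ⊔ ℓ₁)
    algebra = record
      { Carrier = Term ; _≈_ = _≋_ ; _+_ = _⊕_ ; _*_ = _⊗_ ; -_ = ⊖_ ; 0# = ι 0# ; 1# = ι 1#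
      ; isRing = record
        { +-isAbelianGroup = record
          { isGroup = record
            { isMonoid = record
              { isSemigroup = record
                { isMagma = record
                  { isEquivalence = record { refl = ≋-refl ; sym = ≋-sym ; trans = ≋-trans }
                  ; ∙-cong = ⊕-cong }
                ; assoc = ⊕-assoc }
              ; identity = ⊕-identityˡ , λ x → ≋-trans (⊕-comm x (ι 0#)) (⊕-identityˡ x) }
            ; inverse = ⊕-inverseˡ , λ x → ≋-trans (⊕-comm x (⊖ x)) (⊕-inverseˡ x)
            ; ⁻¹-cong = ⊖-cong }
          ; comm = ⊕-comm }
        ; *-cong = ⊗-cong
        ; *-assoc = ⊗-assoc
        ; *-identity = ⊗-identityˡ , ⊗-identityʳ
        ; distrib = ⊗-distribˡ-⊕ , ⊗-distribʳ-⊕ } }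

    open MonoidSum (Ring.+-monoid algebra) public using () renaming (sum to sumᵀ)

    -- V ^ rₙ U ^ sₙ ⋯ V ^ r₁ U ^ s₁, the vectors listing r₁, …, rₙ and s₁, …, sₙ.
    H : ∀ {n} → Vec ℕ n → Vec ℕ n → Term
    H []       []       = ι 1#
    H (r ∷ rs) (s ∷ ss) = H rs ss ⊗ (V ^ᵀ r ⊗ U ^ᵀ s)

    -- Only used with coefficient 0 when the exponent of V is negative.
    monomial : ℤ → ℕ → Term
    monomial (+ i)    k = V ^ᵀ i ⊗ U ^ᵀ k
    monomial -[1+ _ ] k = ι 0#

    record IsNormalOrdering {n} (rs ss : Vec ℕ (suc n)) (S : ℕ → Carrier) : Set (c ⊔ ℓ₁) where
      field
        expansion :
          H rs ss ≋ sumᵀ {suc (Vec.sum ss ∸ Vec.head ss)} λ i →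
            let k = Vec.head ss ℕ.+ toℕ i in
            ι (S k) ⊗ monomial (exponentV s rs ss k) k
        zero-negative : ∀ k → exponentV s rs ss k ℤ.< 0ℤ → S k ≈ 0#
        zero-below    : ∀ k → k ℕ.< Vec.head ss → S k ≈ 0#
        zero-above    : ∀ k → Vec.sum ss ℕ.< k → S k ≈ 0#

{-# OPTIONS --safe #-}

-- The algebra acts on K[x, x⁻¹] by V x ^ a = x ^ (a + 1) and U x ^ a = h [a] x ^ (a - d), where
-- d = 1 - s. Comparing both sides of the normal ordering expansion on x ^ (j d) gives
--   h ^ ∣s∣ Ω[j] = Σ_k S[k] h ^ k [j d] [(j - 1) d] ⋯ [(j - k + 1) d]
-- for every j, and this triangular system is inverted by the operators (E - 1)(E - p) ⋯ (E - p ^ (k - 1))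
-- at j = 0, where p = q ^ d and (E f) j = f (j + 1): by the q-Pascal rule they are dual to the products
-- on the right, and they send Ω to the alternating Gaussian sum.

module Submission where

open import Defs
open import Algebra.Apartness.Bundles using (HeytingField)
open import Algebra.Bundles using (CommutativeMonoid; CommutativeRing)
import Algebra.Properties.CommutativeSemiring.Exp as Exp
import Algebra.Properties.Monoid.Sum as MonoidSum
import Algebra.Properties.Ring as RingProperties
import Algebra.Properties.Semiring.Sum as Sum
import Algebra.Solver.Ring.NaturalCoefficients.Default as SemiringSolver
open import Data.Fin.Base using (Fin; zero; suc; toℕ)
open import Data.Fin.Properties using (toℕ<n)
open import Data.Integer.Base as ℤ using (ℤ; +_; -[1+_]; 0ℤ; 1ℤ)
import Data.Integer.DivMod as ℤ
import Data.Integer.Properties as ℤ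
open import Data.Integer.Tactic.RingSolver using (solve-∀)
open import Data.Nat.Base as ℕ using (ℕ; zero; suc; _∸_)
open import Data.Nat.Combinatorics using (_C_; nC1≡n; nCk+nC[k+1]≡[n+1]C[k+1])
import Data.Nat.Properties as ℕ
open import Data.Product.Base using (_,_; proj₁)
open import Data.Rational.Unnormalised.Base as ℚ using (mkℚᵘ; *≡*; floor)
import Data.Rational.Unnormalised.Properties as ℚ
import Data.Rational.Unnormalised.Solver as ℚ
open import Data.Sum.Base using (_⊎_; inj₁; inj₂)
open import Data.Vec.Base as Vec using (Vec; []; _∷_)
open import Relation.Binary.PropositionalEquality.Core as ≡ using (_≡_; _≢_)
open import Relation.Binary.PropositionalEquality.Properties using (module ≡-Reasoning)
import Relation.Binary.Reasoning.Setoid as SetoidReasoning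
open import Relation.Nullary.Decidable.Core using (yes; no)
open import Relation.Nullary.Negation using (contradiction)

-- The action is the q-analogue of V = x, U = h x ^ s (d/dx): the q-derivative D satisfies D x - q x
-- D = 1, and multiplying by h x ^ s gives the defining relation, since a - 1 + s = a - d. The
-- exponents a = j d are the right test points for two reasons. There the product with k factors
-- contains [0] as soon as k > j, which makes the system triangular; and neighbouring points differ
-- by the step d of the products, which is what the q-Pascal rule needs.
--
-- Inverses of h and of factorials are postponed. The weights of the difference operators are
-- defined by a recursion, so that duality holds in every commutative ring and for every base p.
-- Only at the end are the weights identified with Gaussian coefficients and the resulting identity
-- divided by h ^ k [k]!.

[1+n]C2≡nC2+n : ∀ n → suc n C 2 ≡ n C 2 ℕ.+ n
[1+n]C2≡nC2+n n = ≡.trans (≡.sym (nCk+nC[k+1]≡[n+1]C[k+1] n 1))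
  (≡.trans (≡.cong (ℕ._+ n C 2) (nC1≡n n)) (ℕ.+-comm n (n C 2)))

-- Additivity over the integers from a successor rule.

module IntegerPowers {a ℓ} (M : CommutativeMonoid a ℓ) where
  open CommutativeMonoid M
  open SetoidReasoning setoid

  -- Induction on i in both directions: going down, the invertible `g` is cancelled. This avoids a
  -- case split on the signs of i, j and i + j, and it serves the powers of a unit and the multiples
  -- of `1#` alike.
  homo-+ : (e : ℤ → Carrier) {g g⁻¹ : Carrier} → g⁻¹ ∙ g ≈ ε →
           e 0ℤ ≈ ε → (∀ i → e (ℤ.suc i) ≈ g ∙ e i) →
           ∀ i j → e (i ℤ.+ j) ≈ e i ∙ e j
  homo-+ e {g} {g⁻¹} inverse e0 e-suc i j = go i
    where
    cancel : ∀ {x y} → g ∙ x ≈ g ∙ y → x ≈ y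
    cancel {x} {y} eq = begin
      x              ≈⟨ identityˡ x ⟨
      ε ∙ x          ≈⟨ ∙-congʳ inverse ⟨
      g⁻¹ ∙ g ∙ x    ≈⟨ assoc _ _ _ ⟩
      g⁻¹ ∙ (g ∙ x)  ≈⟨ ∙-congˡ eq ⟩
      g⁻¹ ∙ (g ∙ y)  ≈⟨ assoc _ _ _ ⟨
      g⁻¹ ∙ g ∙ y    ≈⟨ ∙-congʳ inverse ⟩
      ε ∙ y          ≈⟨ identityˡ y ⟩
      y              ∎

    P : ℤ → Set _
    P i = e (i ℤ.+ j) ≈ e i ∙ e j

    shift : ∀ i → e (ℤ.suc i ℤ.+ j) ≈ g ∙ e (i ℤ.+ j)
    shift i = trans (reflexive (≡.cong e (ℤ.+-assoc (+ 1) i j))) (e-suc (i ℤ.+ j))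

    up : ∀ i → P i → P (ℤ.suc i)
    up i ih = begin
      e (ℤ.suc i ℤ.+ j)  ≈⟨ shift i ⟩
      g ∙ e (i ℤ.+ j)    ≈⟨ ∙-congˡ ih ⟩
      g ∙ (e i ∙ e j)    ≈⟨ assoc _ _ _ ⟨
      g ∙ e i ∙ e j      ≈⟨ ∙-congʳ (e-suc i) ⟨
      e (ℤ.suc i) ∙ e j  ∎

    down : ∀ i → P (ℤ.suc i) → P i
    down i ih = cancel (begin
      g ∙ e (i ℤ.+ j)    ≈⟨ shift i ⟨
      e (ℤ.suc i ℤ.+ j)  ≈⟨ ih ⟩
      e (ℤ.suc i) ∙ e j  ≈⟨ ∙-congʳ (e-suc i) ⟩
      g ∙ e i ∙ e j      ≈⟨ assoc _ _ _ ⟩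
      g ∙ (e i ∙ e j)    ∎)

    base : P 0ℤ
    base = begin
      e (0ℤ ℤ.+ j)  ≡⟨ ≡.cong e (ℤ.+-identityˡ j) ⟩
      e j           ≈⟨ identityˡ (e j) ⟨
      ε ∙ e j       ≈⟨ ∙-congʳ e0 ⟨
      e 0ℤ ∙ e j    ∎

    go : ∀ i → P i
    go (+ zero)        = base
    go (+ suc n)       = up (+ n) (go (+ n))
    go -[1+ zero ]     = down -[1+ 0 ] base
    go -[1+ suc n ]    = down -[1+ suc n ] (go -[1+ n ])

-- q-difference operators: closed form of their weights, and duality.

module Inversion {c ℓ} (R : CommutativeRing c ℓ) (p : CommutativeRing.Carrier R) where
  open CommutativeRing R hiding (zero)
  open RingProperties ring using (-1*x≈-x)
  open Exp commutativeSemiring using (_^_; ^-homo-*; ^-congʳ)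
  open Sum semiring
  open SemiringSolver commutativeSemiring using (solve; _:=_; _:+_; _:*_; con)
  open SetoidReasoning setoid

  x+-1*x≈0 : ∀ x → x + - 1# * x ≈ 0#
  x+-1*x≈0 x = trans (+-congˡ (-1*x≈-x x)) (-‿inverseʳ x)

  sum-last : ∀ n (g : ℕ → Carrier) → ∑[ i < suc n ] g (toℕ i) ≈ ∑[ i < n ] g (toℕ i) + g n
  sum-last zero    g = +-comm _ _
  sum-last (suc n) g = trans (+-congˡ (sum-last n (λ i → g (suc i)))) (sym (+-assoc _ _ _))

  sum-zero : ∀ m (g : ℕ → Carrier) → (∀ i → g i ≈ 0#) → ∑[ i < m ] g (toℕ i) ≈ 0#
  sum-zero m g g≈0 = trans (sum-cong-≋ {m} λ i → g≈0 (toℕ i)) (sum-replicate-zero m)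

  -- The last hypothesis admits an index `l` beyond the range, where the sum is empty of nonzero
  -- terms and `g l` has to vanish as well.
  sum-single : ∀ m (g : ℕ → Carrier) l → (∀ i → i ≢ l → g i ≈ 0#) → (m ℕ.≤ l → g l ≈ 0#) →
               ∑[ i < m ] g (toℕ i) ≈ g l
  sum-single zero    g l       off out = sym (out ℕ.z≤n)
  sum-single (suc m) g zero    off out = trans
    (+-congˡ (sum-zero m (λ i → g (suc i)) λ i → off (suc i) λ ())) (+-identityʳ _)
  sum-single (suc m) g (suc l) off out = trans
    (+-cong (off 0 λ ()) (sum-single m (λ i → g (suc i)) l
      (λ i i≢l → off (suc i) λ 1+i≡1+l → i≢l (ℕ.suc-injective 1+i≡1+l)) λ m≤l → out (ℕ.s≤s m≤l)))
    (+-identityˡ _)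

  -- (- 1) ^ (k - j) p ^ C(k - j, 2) times the Gaussian coefficient (k , j) in base p.
  weight : ℕ → ℕ → Carrier
  weight zero    zero    = 1#
  weight zero    (suc j) = 0#
  weight (suc k) zero    = - 1# * p ^ k * weight k zero
  weight (suc k) (suc j) = weight k j + - 1# * p ^ k * weight k (suc j)

  weight-above : ∀ k j → k ℕ.< j → weight k j ≈ 0#
  weight-above zero    (suc j) _           = refl
  weight-above (suc k) (suc j) (ℕ.s≤s k<j) = begin
    weight k j + - 1# * p ^ k * weight k (suc j)
      ≈⟨ +-cong (weight-above k j k<j) (*-congˡ (weight-above k (suc j) (ℕ.m<n⇒m<1+n k<j))) ⟩
    0# + - 1# * p ^ k * 0#
      ≈⟨ trans (+-identityˡ _) (zeroʳ _) ⟩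
    0# ∎

  sign : ℕ → Carrier
  sign m = (- 1#) ^ m * p ^ (m C 2)

  p^[1+m]C2 : ∀ m → p ^ (suc m C 2) ≈ p ^ (m C 2) * p ^ m
  p^[1+m]C2 m = trans (^-congʳ p ([1+n]C2≡nC2+n m)) (^-homo-* p (m C 2) m)

  weight-zero : ∀ k → weight k 0 ≈ sign k
  weight-zero zero    = sym (*-identityˡ 1#)
  weight-zero (suc k) = begin
    - 1# * p ^ k * weight k 0                   ≈⟨ *-congˡ (weight-zero k) ⟩
    - 1# * p ^ k * ((- 1#) ^ k * p ^ (k C 2))
      ≈⟨ solve 4 (λ m x y z → m :* x :* (y :* z) := m :* y :* (z :* x)) refl
           (- 1#) (p ^ k) ((- 1#) ^ k) (p ^ (k C 2)) ⟩
    - 1# * (- 1#) ^ k * (p ^ (k C 2) * p ^ k)   ≈⟨ *-congˡ (p^[1+m]C2 k) ⟨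
    sign (suc k)                                ∎

  module _ (N F : ℕ → Carrier)
           (N-+ : ∀ a b → N (a ℕ.+ b) ≈ N a + p ^ a * N b)
           (F0 : F 0 ≈ 1#) (F-suc : ∀ n → F (suc n) ≈ N (suc n) * F n) where

    -- The Gaussian formula with its denominators cleared. `k` is kept apart from j + m because the
    -- induction step needs two decompositions of it, j + (1 + m) and (1 + j) + m, one for each term
    -- of the recursion.
    weight-closed : ∀ k j m → k ≡ j ℕ.+ m → weight k j * (F j * F m) ≈ sign m * F k
    weight-closed zero zero zero _ = begin
      1# * (F 0 * F 0)  ≈⟨ *-congˡ (*-congʳ F0) ⟩
      1# * (1# * F 0)   ≈⟨ *-assoc _ _ _ ⟨
      1# * 1# * F 0     ∎
    weight-closed (suc k) zero (suc m) ≡.refl = begin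
      weight (suc k) 0 * (F 0 * F (suc k))  ≈⟨ *-cong (weight-zero (suc k)) (*-congʳ F0) ⟩
      sign (suc k) * (1# * F (suc k))       ≈⟨ *-congˡ (*-identityˡ _) ⟩
      sign (suc k) * F (suc k)              ∎
    weight-closed (suc k) (suc j) zero eq = begin
      (weight k j + - 1# * p ^ k * weight k (suc j)) * (F (suc j) * F 0)
        -- On the diagonal j = k the second term of the recursion lies above the triangle.
        ≈⟨ *-congʳ (+-congˡ (*-congˡ (weight-above k (suc j) k<1+j))) ⟩
      (weight k j + - 1# * p ^ k * 0#) * (F (suc j) * F 0)
        ≈⟨ *-congʳ (trans (+-congˡ (zeroʳ _)) (+-identityʳ _)) ⟩
      weight k j * (F (suc j) * F 0)
        ≈⟨ *-congˡ (*-congʳ (F-suc j)) ⟩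
      weight k j * (N (suc j) * F j * F 0)
        ≈⟨ solve 4 (λ w n f g → w :* (n :* f :* g) := n :* (w :* (f :* g))) refl _ _ _ _ ⟩
      N (suc j) * (weight k j * (F j * F 0))
        ≈⟨ *-congˡ (weight-closed k j zero k≡j+0) ⟩
      N (suc j) * (sign 0 * F k)
        ≈⟨ solve 3 (λ n s f → n :* (s :* f) := s :* (n :* f)) refl _ _ _ ⟩
      sign 0 * (N (suc j) * F k)
        ≡⟨ ≡.cong (λ i → sign 0 * (N (suc i) * F k)) k≡j ⟨
      sign 0 * (N (suc k) * F k)
        ≈⟨ *-congˡ (F-suc k) ⟨
      sign 0 * F (suc k) ∎
      where
      k≡j+0 : k ≡ j ℕ.+ 0
      k≡j+0 = ℕ.suc-injective eq
      k≡j : k ≡ j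
      k≡j = ≡.trans k≡j+0 (ℕ.+-identityʳ j)
      k<1+j : k ℕ.< suc j
      k<1+j = ℕ.s≤s (ℕ.≤-reflexive k≡j)
    weight-closed (suc k) (suc j) (suc m) eq = begin
      (weight k j + - 1# * p ^ k * weight k (suc j)) * (F (suc j) * F (suc m))
        ≈⟨ *-cong (+-congˡ (*-congʳ (*-congˡ pᵏ))) (*-cong (F-suc j) (F-suc m)) ⟩
      (weight k j + - 1# * (p ^ suc j * p ^ m) * weight k (suc j)) * (N (suc j) * F j * (N (suc m) * F m))
        ≈⟨ solve 9 (λ w w′ ε x y n f n′ f′ →
             (w :+ ε :* (x :* y) :* w′) :* (n :* f :* (n′ :* f′)) :=
             n :* (w :* (f :* (n′ :* f′))) :+ ε :* (x :* y) :* n′ :* (w′ :* (n :* f :* f′)))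
             refl _ _ _ _ _ _ _ _ _ ⟩
      N (suc j) * (weight k j * (F j * (N (suc m) * F m))) +
      - 1# * (p ^ suc j * p ^ m) * N (suc m) * (weight k (suc j) * (N (suc j) * F j * F m))
        ≈⟨ +-cong (*-congˡ ih₁) (*-congˡ ih₂) ⟩
      N (suc j) * (- 1# * (- 1#) ^ m * (p ^ (m C 2) * p ^ m) * F k) +
      - 1# * (p ^ suc j * p ^ m) * N (suc m) * ((- 1#) ^ m * p ^ (m C 2) * F k)
        -- Both induction hypotheses carry the sign and power of p that belong to 1 + m. What is
        -- left is [j + 1] + p ^ (j + 1) [m + 1], which `N-+` contracts to [k + 1].
        ≈⟨ solve 8 (λ n n′ ε σ x y z f →
             n :* (ε :* σ :* (z :* y) :* f) :+ ε :* (x :* y) :* n′ :* (σ :* z :* f) :=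
             ε :* σ :* (z :* y) :* ((n :+ x :* n′) :* f))
             refl _ _ _ _ _ _ _ _ ⟩
      - 1# * (- 1#) ^ m * (p ^ (m C 2) * p ^ m) * ((N (suc j) + p ^ suc j * N (suc m)) * F k)
        ≈⟨ *-cong (*-congˡ (p^[1+m]C2 m)) (*-congʳ (N-+ (suc j) (suc m))) ⟨
      sign (suc m) * (N (suc j ℕ.+ suc m) * F k)
        ≡⟨ ≡.cong (λ i → sign (suc m) * (N i * F k)) eq ⟨
      sign (suc m) * (N (suc k) * F k)
        ≈⟨ *-congˡ (F-suc k) ⟨
      sign (suc m) * F (suc k) ∎
      where
      k≡j+1+m : k ≡ j ℕ.+ suc m
      k≡j+1+m = ℕ.suc-injective eq
      k≡1+j+m : k ≡ suc j ℕ.+ m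
      k≡1+j+m = ≡.trans k≡j+1+m (ℕ.+-suc j m)
      pᵏ : p ^ k ≈ p ^ suc j * p ^ m
      pᵏ = trans (^-congʳ p k≡1+j+m) (^-homo-* p (suc j) m)
      ih₁ : weight k j * (F j * (N (suc m) * F m)) ≈ - 1# * (- 1#) ^ m * (p ^ (m C 2) * p ^ m) * F k
      ih₁ = trans (*-congˡ (*-congˡ (sym (F-suc m))))
                  (trans (weight-closed k j (suc m) k≡j+1+m) (*-congʳ (*-congˡ (p^[1+m]C2 m))))
      ih₂ : weight k (suc j) * (N (suc j) * F j * F m) ≈ (- 1#) ^ m * p ^ (m C 2) * F k
      ih₂ = trans (*-congˡ (*-congʳ (sym (F-suc j)))) (weight-closed k (suc j) m k≡1+j+m)

  -- The q-difference operator (E - 1)(E - p) ⋯ (E - p ^ (k - 1)) at 0, where (E f) j = f (j + 1).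
  difference : ℕ → (ℕ → Carrier) → Carrier
  difference k f = ∑[ j < suc k ] (weight k (toℕ j) * f (toℕ j))

  difference-cong : ∀ k {f g} → (∀ j → f j ≈ g j) → difference k f ≈ difference k g
  difference-cong k f≈g = sum-cong-≋ {suc k} λ j → *-congˡ {weight k (toℕ j)} (f≈g (toℕ j))

  difference-+ : ∀ k f g → difference k (λ j → f j + g j) ≈ difference k f + difference k g
  difference-+ k f g = trans (sum-cong-≋ {suc k} λ j → distribˡ (weight k (toℕ j)) (f (toℕ j)) (g (toℕ j)))
    (∑-distrib-+ {suc k} (λ j → weight k (toℕ j) * f (toℕ j)) (λ j → weight k (toℕ j) * g (toℕ j)))

  difference-* : ∀ k x f → difference k (λ j → x * f j) ≈ x * difference k f
  difference-* k x f = trans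
    (sum-cong-≋ {suc k} λ j → solve 3 (λ w x f → w :* (x :* f) := x :* (w :* f)) refl
      (weight k (toℕ j)) x (f (toℕ j)))
    (sym (*-distribˡ-sum {suc k} x (λ j → weight k (toℕ j) * f (toℕ j))))

  difference-sum : ∀ k m (f : ℕ → ℕ → Carrier) →
    difference k (λ j → ∑[ i < m ] f (toℕ i) j) ≈ ∑[ i < m ] difference k (f (toℕ i))
  difference-sum k zero    f = begin
    difference k (λ _ → 0#)       ≈⟨ difference-cong k (λ _ → zeroˡ 0#) ⟨
    difference k (λ _ → 0# * 0#)  ≈⟨ difference-* k 0# (λ _ → 0#) ⟩
    0# * difference k (λ _ → 0#)  ≈⟨ zeroˡ _ ⟩
    0#                            ∎
  difference-sum k (suc m) f = trans
    (difference-+ k (f 0) (λ j → ∑[ i < m ] f (suc (toℕ i)) j))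
    (+-congˡ (difference-sum k m (λ i → f (suc i))))

  -- The recursion of `weight` is multiplication of a polynomial in E by E - p ^ k. In the part
  -- multiplied by - p ^ k the sum runs one index too far, and `weight-above` removes the extra
  -- term.
  difference-suc : ∀ k f →
    difference (suc k) f ≈ difference k (λ j → f (suc j)) + - 1# * p ^ k * difference k f
  difference-suc k f = begin
    v * weight k 0 * f 0 + ∑[ j < suc k ] ((weight k (toℕ j) + v * weight k (suc (toℕ j))) * f (suc (toℕ j)))
      ≈⟨ +-cong (*-assoc _ _ _) (sum-cong-≋ {suc k} λ j →
           solve 4 (λ w v x f → (w :+ v :* x) :* f := w :* f :+ v :* (x :* f)) refl
             (weight k (toℕ j)) v (weight k (suc (toℕ j))) (f (suc (toℕ j)))) ⟩
    v * (weight k 0 * f 0) + ∑[ j < suc k ] (weight k (toℕ j) * f (suc (toℕ j)) + v * g (suc (toℕ j)))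
      ≈⟨ +-congˡ (∑-distrib-+ {suc k} (λ j → weight k (toℕ j) * f (suc (toℕ j))) (λ j → v * g (suc (toℕ j)))) ⟩
    v * (weight k 0 * f 0) + (difference k (λ j → f (suc j)) + ∑[ j < suc k ] (v * g (suc (toℕ j))))
      ≈⟨ +-congˡ (+-congˡ (*-distribˡ-sum {suc k} v (λ j → g (suc (toℕ j))))) ⟨
    v * (weight k 0 * f 0) + (difference k (λ j → f (suc j)) + v * ∑[ j < suc k ] g (suc (toℕ j)))
      ≈⟨ solve 4 (λ v x d y → v :* x :+ (d :+ v :* y) := d :+ v :* (x :+ y)) refl _ _ _ _ ⟩
    difference k (λ j → f (suc j)) + v * ∑[ j < suc (suc k) ] g (toℕ j)
      ≈⟨ +-congˡ (*-congˡ (sum-last (suc k) g)) ⟩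
    difference k (λ j → f (suc j)) + v * (difference k f + g (suc k))
      ≈⟨ +-congˡ (*-congˡ (trans (+-congˡ g[1+k]≈0) (+-identityʳ _))) ⟩
    difference k (λ j → f (suc j)) + v * difference k f ∎
    where
    v = - 1# * p ^ k
    g : ℕ → Carrier
    g j = weight k j * f j
    g[1+k]≈0 : g (suc k) ≈ 0#
    g[1+k]≈0 = trans (*-congʳ (weight-above k (suc k) ℕ.≤-refl)) (zeroˡ _)

  module _ (φ : ℕ → ℕ → Carrier) (x : ℕ → Carrier)
           (φ0 : ∀ j → φ 0 j ≈ 1#) (φ-suc-0 : ∀ i → φ (suc i) 0 ≈ 0#)
           (φ-suc-suc : ∀ i j → φ (suc i) (suc j) ≈ x (suc i) * φ i j + p ^ suc i * φ (suc i) j)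
           where

    private
      -- By the q-Pascal hypothesis, E - p ^ k sends `φ (suc i)` to a multiple of `φ i` plus p ^ (i
      -- + 1) - p ^ k times `φ (suc i)` itself.
      step : ∀ k i → difference (suc k) (φ (suc i)) ≈
             x (suc i) * difference k (φ i) + (p ^ suc i + - 1# * p ^ k) * difference k (φ (suc i))
      step k i = begin
        difference (suc k) (φ (suc i))
          ≈⟨ difference-suc k (φ (suc i)) ⟩
        difference k (λ j → φ (suc i) (suc j)) + v * d
          ≈⟨ +-congʳ (trans (difference-cong k (φ-suc-suc i))
               (trans (difference-+ k (λ j → x (suc i) * φ i j) (λ j → p ^ suc i * φ (suc i) j))
                 (+-cong (difference-* k (x (suc i)) (φ i)) (difference-* k (p ^ suc i) (φ (suc i)))))) ⟩
        x (suc i) * difference k (φ i) + p ^ suc i * d + v * d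
          ≈⟨ solve 4 (λ a b v d → a :+ b :* d :+ v :* d := a :+ (b :+ v) :* d) refl _ _ _ _ ⟩
        x (suc i) * difference k (φ i) + (p ^ suc i + v) * d ∎
        where
        v = - 1# * p ^ k
        d = difference k (φ (suc i))

      difference-zero : ∀ f → difference 0 f ≈ f 0
      difference-zero f = trans (+-identityʳ _) (*-identityˡ _)

      -- The factor E - 1, present because p ^ 0 = 1, already kills constants; the remaining factors
      -- preserve zero.
      difference-constant : ∀ k → difference (suc k) (φ 0) ≈ 0#
      difference-constant k = begin
        difference (suc k) (φ 0)
          ≈⟨ difference-suc k (φ 0) ⟩
        difference k (λ j → φ 0 (suc j)) + - 1# * p ^ k * difference k (φ 0)
          ≈⟨ +-congʳ (difference-cong k λ j → trans (φ0 (suc j)) (sym (φ0 j))) ⟩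
        difference k (φ 0) + - 1# * p ^ k * difference k (φ 0)
          ≈⟨ vanish k ⟩
        0# ∎
        where
        vanish : ∀ k → difference k (φ 0) + - 1# * p ^ k * difference k (φ 0) ≈ 0#
        vanish zero    = trans (+-congˡ (*-congʳ (*-identityʳ _))) (x+-1*x≈0 _)
        vanish (suc k) = trans (+-cong d≈0 (trans (*-congˡ d≈0) (zeroʳ _))) (+-identityˡ 0#)
          where d≈0 = difference-constant k

    -- Induction on the number of factors through `step`. The first term vanishes by induction; in
    -- the second either k = i + 1 and the scalar p ^ (i + 1) - p ^ k is zero, or the induction
    -- hypothesis applies again. Thus no power of p has to be distinguished from another.
    difference-off : ∀ k i → k ≢ i → difference k (φ i) ≈ 0#
    difference-off zero    zero    k≢i = contradiction ≡.refl k≢i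
    difference-off zero    (suc i) k≢i = trans (difference-zero (φ (suc i))) (φ-suc-0 i)
    difference-off (suc k) zero    k≢i = difference-constant k
    difference-off (suc k) (suc i) k≢i = begin
      difference (suc k) (φ (suc i))
        ≈⟨ step k i ⟩
      x (suc i) * difference k (φ i) + (p ^ suc i + - 1# * p ^ k) * difference k (φ (suc i))
        ≈⟨ +-cong (trans (*-congˡ (difference-off k i λ k≡i → k≢i (≡.cong suc k≡i))) (zeroʳ _)) (cross k i) ⟩
      0# + 0#
        ≈⟨ +-identityˡ 0# ⟩
      0# ∎
      where
      cross : ∀ k i → (p ^ suc i + - 1# * p ^ k) * difference k (φ (suc i)) ≈ 0#
      cross k i with k ℕ.≟ suc i
      ... | yes ≡.refl = trans (*-congʳ (x+-1*x≈0 _)) (zeroˡ _)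
      ... | no  k≢1+i  = trans (*-congˡ (difference-off k (suc i) k≢1+i)) (zeroʳ _)

    difference-on : ∀ (F : ℕ → Carrier) → F 0 ≈ 1# → (∀ n → F (suc n) ≈ x (suc n) * F n) →
                    ∀ k → difference k (φ k) ≈ F k
    difference-on F F0 F-suc zero    = trans (difference-zero (φ 0)) (trans (φ0 0) (sym F0))
    difference-on F F0 F-suc (suc k) = begin
      difference (suc k) (φ (suc k))
        ≈⟨ step k k ⟩
      x (suc k) * difference k (φ k) + (p ^ suc k + - 1# * p ^ k) * difference k (φ (suc k))
        ≈⟨ +-cong (*-congˡ (difference-on F F0 F-suc k))
                  (trans (*-congˡ (difference-off k (suc k) (ℕ.<⇒≢ ℕ.≤-refl))) (zeroʳ _)) ⟩
      x (suc k) * F k + 0#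
        ≈⟨ +-identityʳ _ ⟩
      x (suc k) * F k
        ≈⟨ F-suc k ⟨
      F (suc k) ∎

-- Evaluating the floors by which integral rationals are read.

floor-cong-fromℤ : ∀ p z → p ℚ.≃ fromℤ z → floor p ≡ z
floor-cong-fromℤ p@(mkℚᵘ n d-1) z (*≡* n*1≡z*d) = ≡.sym (ℤ.i-j≡0⇒i≡j z w (ℤ.∣i∣≡0⇒i≡0 ∣z-w∣≡0))
  where
  d = + suc d-1
  w = n ℤ./ d
  n≡zd : n ≡ z ℤ.* d
  n≡zd = ≡.trans (≡.sym (ℤ.*-identityʳ n)) n*1≡z*d

  -- The remainder is a multiple of d and smaller than d, which forces the quotient `w` to be `z`.
  n%d≡[z-w]d : + (n ℤ.% d) ≡ (z ℤ.- w) ℤ.* d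
  n%d≡[z-w]d = begin
    + (n ℤ.% d)                              ≡⟨ rearrange₁ (+ (n ℤ.% d)) (w ℤ.* d) ⟩
    + (n ℤ.% d) ℤ.+ w ℤ.* d ℤ.- w ℤ.* d      ≡⟨ ≡.cong (ℤ._- w ℤ.* d) (ℤ.a≡a%n+[a/n]*n n d) ⟨
    n ℤ.- w ℤ.* d                            ≡⟨ ≡.cong (ℤ._- w ℤ.* d) n≡zd ⟩
    z ℤ.* d ℤ.- w ℤ.* d                      ≡⟨ rearrange₂ z w d ⟩
    (z ℤ.- w) ℤ.* d                          ∎
    where
    open ≡-Reasoning
    rearrange₁ : ∀ x y → x ≡ x ℤ.+ y ℤ.- y
    rearrange₁ = solve-∀
    rearrange₂ : ∀ x y z → x ℤ.* z ℤ.- y ℤ.* z ≡ (x ℤ.- y) ℤ.* z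
    rearrange₂ = solve-∀

  ∣z-w∣≡0 : ℤ.∣ z ℤ.- w ∣ ≡ 0
  ∣z-w∣≡0 = ℕ.n<1⇒n≡0 (ℕ.*-cancelʳ-< (suc d-1) ℤ.∣ z ℤ.- w ∣ 1 (begin-strict
    ℤ.∣ z ℤ.- w ∣ ℕ.* suc d-1  ≡⟨ ℤ.abs-* (z ℤ.- w) d ⟨
    ℤ.∣ (z ℤ.- w) ℤ.* d ∣      ≡⟨ ≡.cong ℤ.∣_∣ n%d≡[z-w]d ⟨
    n ℤ.% d                    <⟨ ℤ.n%d<d n d ⟩
    suc d-1                    ≡⟨ ℕ.*-identityˡ (suc d-1) ⟨
    1 ℕ.* suc d-1              ∎))
    where open ℕ.≤-Reasoning

floor-quotient : ∀ j a b i d .{{_ : ℤ.NonZero d}} →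
  floor ((fromℤ j ℚ.- fromℤ a ℚ.+ fromℤ b ℚ.÷ fromℤ d ℚ.- fromℤ i) ℚ.* fromℤ d)
    ≡ j ℤ.* d ℤ.- a ℤ.* d ℤ.+ b ℤ.- i ℤ.* d
floor-quotient j a b i d = floor-cong-fromℤ _ _ (begin
  (J ℚ.- A ℚ.+ B ℚ.* ℚ.1/ D ℚ.- I) ℚ.* D
    ≈⟨ solve 6 (λ J A B I D r → (J :- A :+ B :* r :- I) :* D := (J :- A :- I) :* D :+ B :* (r :* D))
         ℚ.≃-refl J A B I D (ℚ.1/ D) ⟩
  (J ℚ.- A ℚ.- I) ℚ.* D ℚ.+ B ℚ.* (ℚ.1/ D ℚ.* D)
    ≈⟨ ℚ.+-congʳ ((J ℚ.- A ℚ.- I) ℚ.* D) (ℚ.*-congˡ {B} (ℚ.*-inverseˡ D)) ⟩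
  (J ℚ.- A ℚ.- I) ℚ.* D ℚ.+ B ℚ.* ℚ.1ℚᵘ
    ≈⟨ *≡* (integral j a b i d) ⟩
  fromℤ (j ℤ.* d ℤ.- a ℤ.* d ℤ.+ b ℤ.- i ℤ.* d) ∎)
  where
  open SetoidReasoning ℚ.≃-setoid
  open ℚ.+-*-Solver
  J = fromℤ j
  A = fromℤ a
  B = fromℤ b
  I = fromℤ i
  D = fromℤ d
  -- Once 1/d has been cancelled every denominator is 1; the factors `1ℤ` are what
  -- cross-multiplication of unnormalised fractions leaves.
  integral : ∀ j a b i d →
    ((((j ℤ.* 1ℤ ℤ.+ ℤ.- a ℤ.* 1ℤ) ℤ.* 1ℤ ℤ.+ ℤ.- i ℤ.* 1ℤ) ℤ.* d) ℤ.* 1ℤ ℤ.+ (b ℤ.* 1ℤ) ℤ.* 1ℤ) ℤ.* 1ℤ ≡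
    (j ℤ.* d ℤ.- a ℤ.* d ℤ.+ b ℤ.- i ℤ.* d) ℤ.* 1ℤ
  integral = solve-∀

-- q-numbers and their descending products over a field.

module Field {c ℓ₁ ℓ₂} (K : HeytingField c ℓ₁ ℓ₂) where
  open HeytingField K hiding (zero)
  open OverField K
  open CommutativeRing commutativeRing using (ring; commutativeSemiring; *-monoid; *-commutativeMonoid; +-commutativeMonoid)
  open RingProperties ring using (-‿+-comm; -0#≈0#; -‿distribʳ-*; -1*x≈-x)
  open Exp commutativeSemiring using (^-homo-*)
  open MonoidSum *-monoid using () renaming (sum-cong-≋ to product-cong)
  open SemiringSolver commutativeSemiring using (solve; _:=_; _:+_; _:*_; con)
  open SetoidReasoning setoid

  pow-+ : ∀ {x} (x#0 : x # 0#) i j → pow x x#0 (i ℤ.+ j) ≈ pow x x#0 i * pow x x#0 j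
  pow-+ {x} x#0 = IntegerPowers.homo-+ *-commutativeMonoid (pow x x#0)
    (trans (*-comm _ _) (inv-inverseʳ x#0)) refl pow-suc
    where
    cancel : ∀ y → y ≈ x * (inv x#0 * y)
    cancel y = sym (trans (sym (*-assoc _ _ _)) (trans (*-congʳ (inv-inverseʳ x#0)) (*-identityˡ y)))
    pow-suc : ∀ i → pow x x#0 (ℤ.suc i) ≈ x * pow x x#0 i
    pow-suc (+ n)          = refl
    pow-suc -[1+ zero ]    = cancel 1#
    pow-suc -[1+ suc n ]   = cancel (inv x#0 ^ suc n)

  pow-* : ∀ {x} (x#0 : x # 0#) n d → pow x x#0 (+ n ℤ.* d) ≈ pow x x#0 d ^ n
  pow-* {x} x#0 zero    d = refl
  pow-* {x} x#0 (suc n) d = begin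
    pow x x#0 (+ suc n ℤ.* d)              ≡⟨ ≡.cong (pow x x#0) (ℤ.suc-* (+ n) d) ⟩
    pow x x#0 (d ℤ.+ + n ℤ.* d)            ≈⟨ pow-+ x#0 d (+ n ℤ.* d) ⟩
    pow x x#0 d * pow x x#0 (+ n ℤ.* d)    ≈⟨ *-congˡ (pow-* x#0 n d) ⟩
    pow x x#0 d * pow x x#0 d ^ n          ∎

  fromInteger-+ : ∀ i j → fromInteger (i ℤ.+ j) ≈ fromInteger i + fromInteger j
  fromInteger-+ = IntegerPowers.homo-+ +-commutativeMonoid fromInteger (-‿inverseˡ 1#) refl fromInteger-suc
    where
    cancel : ∀ y → - y ≈ 1# + - (1# + y)
    cancel y = sym (begin
      1# + - (1# + y)       ≈⟨ +-congˡ (-‿+-comm 1# y) ⟨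
      1# + (- 1# + - y)     ≈⟨ +-assoc _ _ _ ⟨
      1# + - 1# + - y       ≈⟨ +-congʳ (-‿inverseʳ 1#) ⟩
      0# + - y              ≈⟨ +-identityˡ _ ⟩
      - y                   ∎)
    fromInteger-suc : ∀ i → fromInteger (ℤ.suc i) ≈ 1# + fromInteger i
    fromInteger-suc (+ n)        = refl
    fromInteger-suc -[1+ zero ]  = trans (sym -0#≈0#) (cancel 0#)
    fromInteger-suc -[1+ suc n ] = cancel (suc n · 1#)

  qNumber-0 : ∀ {q} (adm : Admissible q) → qNumber adm 0ℤ ≈ 0#
  qNumber-0 (q#0 , inj₁ _) = refl
  qNumber-0 (q#0 , inj₂ _) = trans (*-congʳ (-‿inverseʳ 1#)) (zeroˡ _)

  qNumber-1 : ∀ {q} (adm : Admissible q) → qNumber adm 1ℤ ≈ 1#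
  qNumber-1 (q#0 , inj₁ _) = +-identityʳ 1#
  qNumber-1 (q#0 , inj₂ _) = trans (*-congʳ (+-congʳ (*-identityʳ _))) (inv-inverseʳ _)

  qNumber-+ : ∀ {q} (adm : Admissible q) i j →
    qNumber adm (i ℤ.+ j) ≈ qNumber adm i + pow q (proj₁ adm) i * qNumber adm j
  qNumber-+ (q#0 , inj₁ q≈1) i j = trans (fromInteger-+ i j)
    (+-congˡ (sym (trans (*-congʳ (pow-one q#0 q≈1 i)) (*-identityˡ _))))
  qNumber-+ {q} (q#0 , inj₂ _) i j = sym (begin
    (x + m) * r + x * ((y + m) * r)
      -- The solver knows only semirings, so `- 1#` enters as an opaque `m` and the cancellation x +
      -- x m = 0 is supplied separately.
      ≈⟨ solve 4 (λ x y m r → (x :+ m) :* r :+ x :* ((y :+ m) :* r) := (x :* y :+ m :+ (x :+ x :* m)) :* r)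
           refl x y m r ⟩
    (x * y + m + (x + x * m)) * r
      ≈⟨ *-congʳ (trans (+-congˡ x+x*m≈0) (+-identityʳ _)) ⟩
    (x * y + m) * r
      ≈⟨ *-congʳ (+-congʳ (pow-+ q#0 i j)) ⟨
    (pow q q#0 (i ℤ.+ j) + m) * r ∎)
    where
    x = pow q q#0 i
    y = pow q q#0 j
    m = - 1#
    r = inv _
    x+x*m≈0 : x + x * m ≈ 0#
    x+x*m≈0 = trans (+-congˡ (trans (*-comm x m) (-1*x≈-x x))) (-‿inverseʳ x)

  module _ {q} (adm : Admissible q) (d : ℤ) where

    -- The product [a] [a - d] ⋯ [a - (k - 1) d], indexed by the integer a = r d in place of the
    -- rational r. The recursion splits off the last factor, as both `descending-pascal` and the
    -- action of a power of U require.
    descending : ℤ → ℕ → Carrier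
    descending a zero    = 1#
    descending a (suc k) = descending a k * qNumber adm (a ℤ.- + k ℤ.* d)

    descending-suc : ∀ a k → descending a (suc k) ≈ qNumber adm a * descending (a ℤ.- d) k
    descending-suc a zero = begin
      1# * qNumber adm (a ℤ.- 0ℤ)  ≈⟨ *-comm _ _ ⟩
      qNumber adm (a ℤ.- 0ℤ) * 1#  ≡⟨ ≡.cong (λ b → qNumber adm b * 1#) (ℤ.+-identityʳ a) ⟩
      qNumber adm a * 1#           ∎
    descending-suc a (suc k) = begin
      descending a (suc k) * qNumber adm (a ℤ.- + suc k ℤ.* d)
        ≈⟨ *-cong (descending-suc a k) (reflexive (≡.cong (qNumber adm) shift)) ⟩
      qNumber adm a * descending (a ℤ.- d) k * qNumber adm (a ℤ.- d ℤ.- + k ℤ.* d)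
        ≈⟨ *-assoc _ _ _ ⟩
      qNumber adm a * descending (a ℤ.- d) (suc k) ∎
      where
      ring-shift : ∀ a k d → a ℤ.- (1ℤ ℤ.+ k) ℤ.* d ≡ a ℤ.- d ℤ.- k ℤ.* d
      ring-shift = solve-∀
      shift : a ℤ.- + suc k ℤ.* d ≡ a ℤ.- d ℤ.- + k ℤ.* d
      shift = ring-shift a (+ k) d

    falling≈descending : ∀ r a → (∀ i → floor ((r ℚ.- fromℤ (+ i)) ℚ.* fromℤ d) ≡ a ℤ.- + i ℤ.* d) →
                         ∀ k → falling adm d r k ≈ descending a k
    falling≈descending r a floor≡ k =
      trans (product-cong {k} (λ i → reflexive (≡.cong (qNumber adm) (floor≡ (toℕ i))))) (go k a)
      where
      ring-shift : ∀ a i d → a ℤ.- (1ℤ ℤ.+ i) ℤ.* d ≡ a ℤ.- d ℤ.- i ℤ.* d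
      ring-shift = solve-∀
      go : ∀ k a → product {k} (λ i → qNumber adm (a ℤ.- + toℕ i ℤ.* d)) ≈ descending a k
      go zero    a = refl
      go (suc k) a = begin
        qNumber adm (a ℤ.- 0ℤ) * product {k} (λ i → qNumber adm (a ℤ.- + suc (toℕ i) ℤ.* d))
          ≈⟨ *-cong (reflexive (≡.cong (qNumber adm) (ℤ.+-identityʳ a)))
               (product-cong {k} λ i → reflexive (≡.cong (qNumber adm) (ring-shift a (+ toℕ i) d))) ⟩
        qNumber adm a * product {k} (λ i → qNumber adm (a ℤ.- d ℤ.- + toℕ i ℤ.* d))
          ≈⟨ *-congˡ (go k (a ℤ.- d)) ⟩
        qNumber adm a * descending (a ℤ.- d) k
          ≈⟨ descending-suc a k ⟨
        descending a (suc k) ∎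

    factorial≈descending : ∀ n → factorial adm d n ≈ descending (+ n ℤ.* d) n
    factorial≈descending n = falling≈descending (fromℤ (+ n)) (+ n ℤ.* d)
      (λ i → ≡.trans (floor-fromℤ (+ n) (+ i) d) (expand (+ n) (+ i) d)) n
      where
      expand : ∀ a b c → (a ℤ.- b) ℤ.* c ≡ a ℤ.* c ℤ.- b ℤ.* c
      expand = solve-∀

    descending-shift : ∀ j i → descending (+ suc j ℤ.* d) (suc i) ≈
      qNumber adm (+ suc j ℤ.* d) * descending (+ j ℤ.* d) i
    descending-shift j i = trans (descending-suc (+ suc j ℤ.* d) i)
      (*-congˡ (reflexive (≡.cong (λ a → descending a i) (cancel (+ j) d))))
      where
      cancel : ∀ j d → (1ℤ ℤ.+ j) ℤ.* d ℤ.- d ≡ j ℤ.* d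
      cancel = solve-∀

    factorial-suc : ∀ n → factorial adm d (suc n) ≈ qNumber adm (+ suc n ℤ.* d) * factorial adm d n
    factorial-suc n = begin
      factorial adm d (suc n)                                    ≈⟨ factorial≈descending (suc n) ⟩
      descending (+ suc n ℤ.* d) (suc n)                         ≈⟨ descending-shift n n ⟩
      qNumber adm (+ suc n ℤ.* d) * descending (+ n ℤ.* d) n     ≈⟨ *-congˡ (factorial≈descending n) ⟨
      qNumber adm (+ suc n ℤ.* d) * factorial adm d n            ∎

    descending-zero : ∀ i → descending (+ 0 ℤ.* d) (suc i) ≈ 0#
    descending-zero i = trans (descending-suc 0ℤ i) (trans (*-congʳ (qNumber-0 adm)) (zeroˡ _))

    -- Split (j + 1) d as (i + 1) d + (j - i) d and use additivity of q-numbers: [(j - i) d] is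
    -- exactly the factor that prolongs the product of length i starting at j d.
    descending-pascal : ∀ i j → descending (+ suc j ℤ.* d) (suc i) ≈
      qNumber adm (+ suc i ℤ.* d) * descending (+ j ℤ.* d) i +
      pow q (proj₁ adm) d ^ suc i * descending (+ j ℤ.* d) (suc i)
    descending-pascal i j = begin
      descending (+ suc j ℤ.* d) (suc i)
        ≈⟨ descending-shift j i ⟩
      qNumber adm (+ suc j ℤ.* d) * x
        ≡⟨ ≡.cong (λ a → qNumber adm a * x) (split (+ i) (+ j) d) ⟩
      qNumber adm (+ suc i ℤ.* d ℤ.+ (+ j ℤ.* d ℤ.- + i ℤ.* d)) * x
        ≈⟨ *-congʳ (trans (qNumber-+ adm (+ suc i ℤ.* d) _) (+-congˡ (*-congʳ (pow-* (proj₁ adm) (suc i) d)))) ⟩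
      (qNumber adm (+ suc i ℤ.* d) + pow q (proj₁ adm) d ^ suc i * qNumber adm (+ j ℤ.* d ℤ.- + i ℤ.* d)) * x
        ≈⟨ solve 4 (λ n p m x → (n :+ p :* m) :* x := n :* x :+ p :* (x :* m)) refl _ _ _ _ ⟩
      qNumber adm (+ suc i ℤ.* d) * x + pow q (proj₁ adm) d ^ suc i * (x * qNumber adm (+ j ℤ.* d ℤ.- + i ℤ.* d)) ∎
      where
      x = descending (+ j ℤ.* d) i
      split : ∀ i j d → (1ℤ ℤ.+ j) ℤ.* d ≡ (1ℤ ℤ.+ i) ℤ.* d ℤ.+ (j ℤ.* d ℤ.- i ℤ.* d)
      split = solve-∀

    -- The coefficient, up to a power of h, picked up by x ^ a when V ^ rₙ U ^ sₙ ⋯ V ^ r₁ U ^ s₁ acts on it.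
    orbit : ∀ {n} → Vec ℕ n → Vec ℕ n → ℤ → Carrier
    orbit []       []       a = 1#
    orbit (r ∷ rs) (t ∷ ss) a = descending a t * orbit rs ss (+ r ℤ.+ (a ℤ.- + t ℤ.* d))

    -- One block V ^ r U ^ s moves the exponent a to r + (a - s d). Restarting the induction there
    -- absorbs the head entries of all later partial sums.
    product≈orbit : ∀ {n} (rs ss : Vec ℕ n) a →
      product {n} (λ t → descending (a ℤ.- + partialSum ss (toℕ t) ℤ.* d ℤ.+ + partialSum rs (toℕ t)) (Vec.lookup ss t))
        ≈ orbit rs ss a
    product≈orbit []       []       a = refl
    product≈orbit {suc n} (r ∷ rs) (s ∷ ss) a = *-cong
      (reflexive (≡.cong (λ b → descending b s) (≡.trans (ℤ.+-identityʳ _) (ℤ.+-identityʳ a))))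
      (trans (product-cong {n} λ t → reflexive (≡.cong (λ b → descending b (Vec.lookup ss t))
               (rearrange a (+ s) (+ partialSum ss (toℕ t)) (+ r) (+ partialSum rs (toℕ t)) d)))
             (product≈orbit rs ss _))
      where
      rearrange : ∀ a s s′ r r′ d → a ℤ.- (s ℤ.+ s′) ℤ.* d ℤ.+ (r ℤ.+ r′) ≡
                                    r ℤ.+ (a ℤ.- s ℤ.* d) ℤ.- s′ ℤ.* d ℤ.+ r′
      rearrange = solve-∀

  Ω≈orbit : ∀ {q n} (adm : Admissible q) s .{{_ : ℤ.NonZero (1- s)}} (rs ss : Vec ℕ n) j →
            Ω adm s rs ss j ≈ orbit adm (1- s) rs ss (+ j ℤ.* 1- s)
  Ω≈orbit {n = n} adm s rs ss j = trans
    (product-cong {n} λ t → falling≈descending adm (1- s)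
      (fromℤ (+ j) ℚ.- fromℤ (+ partialSum ss (toℕ t)) ℚ.+ fromℤ (+ partialSum rs (toℕ t)) ℚ.÷ fromℤ (1- s))
      (+ j ℤ.* 1- s ℤ.- + partialSum ss (toℕ t) ℤ.* 1- s ℤ.+ + partialSum rs (toℕ t))
      (λ i → floor-quotient (+ j) (+ partialSum ss (toℕ t)) (+ partialSum rs (toℕ t)) (+ i) (1- s))
      (Vec.lookup ss t))
    (product≈orbit adm (1- s) rs ss (+ j ℤ.* 1- s))

  -- The representation of the algebra on linear forms.

  -- act is the transpose of the action on K[x, x⁻¹]: viewing f as the linear form x ^ a ↦ f a,
  -- act t f a is the value of f at t · x ^ a.
  module Representation {q} (adm : Admissible q) (s : ℕ) (h : Carrier) where
    open Algebra s h q

    d : ℤ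
    d = 1- s

    act : Term → (ℤ → Carrier) → ℤ → Carrier
    act (ι x)   f a = x * f a
    act U       f a = h * qNumber adm a * f (a ℤ.- d)
    act V       f a = f (ℤ.suc a)
    act (x ⊕ y) f a = act x f a + act y f a
    act (x ⊗ y) f   = act y (act x f)
    act (⊖ x)   f a = - act x f a

    act-cong : ∀ x {f g} → (∀ a → f a ≈ g a) → ∀ a → act x f a ≈ act x g a
    act-cong (ι x)   f≈g a = *-congˡ (f≈g a)
    act-cong U       f≈g a = *-congˡ (f≈g _)
    act-cong V       f≈g a = f≈g _
    act-cong (x ⊕ y) f≈g a = +-cong (act-cong x f≈g a) (act-cong y f≈g a)
    act-cong (x ⊗ y) f≈g   = act-cong y (act-cong x f≈g)
    act-cong (⊖ x)   f≈g a = -‿cong (act-cong x f≈g a)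

    -- Linearity in the form: homogeneity gives the centrality of scalars in `act-sound`, and
    -- additivity (`act-+`) gives distributivity on the right.
    act-* : ∀ x k f a → act x (λ b → k * f b) a ≈ k * act x f a
    act-* (ι x)   k f a = solve 3 (λ x k f → x :* (k :* f) := k :* (x :* f)) refl x k (f a)
    act-* U       k f a = solve 3 (λ x k f → x :* (k :* f) := k :* (x :* f)) refl _ k _
    act-* V       k f a = refl
    act-* (x ⊕ y) k f a = trans (+-cong (act-* x k f a) (act-* y k f a)) (sym (distribˡ _ _ _))
    act-* (x ⊗ y) k f a = trans (act-cong y (act-* x k f) a) (act-* y k (act x f) a)
    act-* (⊖ x)   k f a = trans (-‿cong (act-* x k f a)) (-‿distribʳ-* _ _)

    act-+ : ∀ x f g a → act x (λ b → f b + g b) a ≈ act x f a + act x g a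
    act-+ (ι x)   f g a = distribˡ _ _ _
    act-+ U       f g a = distribˡ _ _ _
    act-+ V       f g a = refl
    act-+ (x ⊕ y) f g a = trans (+-cong (act-+ x f g a) (act-+ y f g a))
      (solve 4 (λ a b c d → a :+ b :+ (c :+ d) := a :+ c :+ (b :+ d)) refl _ _ _ _)
    act-+ (x ⊗ y) f g a = trans (act-cong y (act-+ x f g) a) (act-+ y (act x f) (act x g) a)
    act-+ (⊖ x)   f g a = trans (-‿cong (act-+ x f g a)) (sym (-‿+-comm _ _))

    act-V^ : ∀ n f a → act (V ^ᵀ n) f a ≈ f (+ n ℤ.+ a)
    act-V^ zero    f a = trans (*-identityˡ _) (reflexive (≡.cong f (≡.sym (ℤ.+-identityˡ a))))
    act-V^ (suc n) f a = trans (act-V^ n (act V f) a) (reflexive (≡.cong f (≡.sym (ℤ.+-assoc 1ℤ (+ n) a))))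

    -- [a + 1] = 1 + q [a] makes the terms with [a] cancel, and 1 - d = s brings all exponents to s
    -- + a.
    act-relation : ∀ f a → act (U ⊗ V ⊕ ⊖ (ι q ⊗ (V ⊗ U))) f a ≈ act (ι h ⊗ V ^ᵀ s) f a
    act-relation f a = begin
      h * qNumber adm (ℤ.suc a) * f (ℤ.suc a ℤ.- d) + - (h * n * (q * f (ℤ.suc (a ℤ.- d))))
        ≈⟨ +-cong (*-cong (*-congˡ qNumber-suc) (reflexive (≡.cong f (shift₁ a (+ s)))))
             (-‿cong (*-congˡ (*-congˡ (reflexive (≡.cong f (shift₂ a (+ s))))))) ⟩
      h * (1# + q * n) * z + - (h * n * (q * z))
        ≈⟨ +-congʳ (solve 4 (λ h q n z → h :* (con 1 :+ q :* n) :* z := h :* z :+ h :* n :* (q :* z)) refl h q n z) ⟩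
      h * z + h * n * (q * z) + - (h * n * (q * z))
        ≈⟨ trans (+-assoc _ _ _) (trans (+-congˡ (-‿inverseʳ _)) (+-identityʳ _)) ⟩
      h * z
        ≈⟨ act-V^ s (act (ι h) f) a ⟨
      act (ι h ⊗ V ^ᵀ s) f a ∎
      where
      n = qNumber adm a
      z = f (+ s ℤ.+ a)
      qNumber-suc : qNumber adm (ℤ.suc a) ≈ 1# + q * n
      qNumber-suc = trans (qNumber-+ adm 1ℤ a) (+-cong (qNumber-1 adm) (*-congʳ (*-identityʳ q)))
      shift₁ : ∀ a s → 1ℤ ℤ.+ a ℤ.- (1ℤ ℤ.- s) ≡ s ℤ.+ a
      shift₁ = solve-∀
      shift₂ : ∀ a s → 1ℤ ℤ.+ (a ℤ.- (1ℤ ℤ.- s)) ≡ s ℤ.+ a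
      shift₂ = solve-∀

    act-sound : ∀ {x y} → x ≋ y → ∀ f a → act x f a ≈ act y f a
    act-sound relation f a = act-relation f a
    act-sound (ι-cong x≈y) f a = *-congʳ x≈y
    act-sound (ι-+ x y) f a = distribʳ _ _ _
    act-sound (ι-* x y) f a = solve 3 (λ x y f → x :* y :* f := y :* (x :* f)) refl x y (f a)
    act-sound (ι-central k x) f a = act-* x k f a
    act-sound ≋-refl f a = refl
    act-sound (≋-sym e) f a = sym (act-sound e f a)
    act-sound (≋-trans e e′) f a = trans (act-sound e f a) (act-sound e′ f a)
    act-sound (⊕-cong e e′) f a = +-cong (act-sound e f a) (act-sound e′ f a)
    act-sound (⊗-cong {y = y} {u = u} e e′) f a =
      trans (act-cong u (act-sound e f) a) (act-sound e′ (act y f) a)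
    act-sound (⊖-cong e) f a = -‿cong (act-sound e f a)
    act-sound (⊕-assoc x y z) f a = +-assoc _ _ _
    act-sound (⊕-comm x y) f a = +-comm _ _
    act-sound (⊕-identityˡ x) f a = trans (+-congʳ (zeroˡ _)) (+-identityˡ _)
    act-sound (⊕-inverseˡ x) f a = trans (-‿inverseˡ _) (sym (zeroˡ _))
    act-sound (⊗-assoc x y z) f a = refl
    act-sound (⊗-identityˡ x) f a = act-cong x (λ b → *-identityˡ (f b)) a
    act-sound (⊗-identityʳ x) f a = *-identityˡ _
    act-sound (⊗-distribˡ-⊕ x y z) f a = refl
    act-sound (⊗-distribʳ-⊕ x y z) f a = act-+ x (act y f) (act z f) a

    act-U^ : ∀ k f a → act (U ^ᵀ k) f a ≈ h ^ k * descending adm d a k * f (a ℤ.- + k ℤ.* d)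
    act-U^ zero    f a = *-cong (sym (*-identityˡ 1#)) (reflexive (≡.cong f (≡.sym (ℤ.+-identityʳ a))))
    act-U^ (suc k) f a = begin
      act (U ^ᵀ k) (act U f) a
        ≈⟨ act-U^ k (act U f) a ⟩
      h ^ k * x * (h * n * f (a ℤ.- + k ℤ.* d ℤ.- d))
        ≈⟨ solve 5 (λ h hk x n f → hk :* x :* (h :* n :* f) := h :* hk :* (x :* n) :* f) refl _ _ _ _ _ ⟩
      h * h ^ k * (x * n) * f (a ℤ.- + k ℤ.* d ℤ.- d)
        ≡⟨ ≡.cong (λ b → h * h ^ k * (x * n) * f b) (shift a (+ k) d) ⟩
      h * h ^ k * (x * n) * f (a ℤ.- + suc k ℤ.* d) ∎
      where
      x = descending adm d a k
      n = qNumber adm (a ℤ.- + k ℤ.* d)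
      shift : ∀ a k d → a ℤ.- k ℤ.* d ℤ.- d ≡ a ℤ.- (1ℤ ℤ.+ k) ℤ.* d
      shift = solve-∀

    act-VU : ∀ r k f a → act (V ^ᵀ r ⊗ U ^ᵀ k) f a ≈
             h ^ k * descending adm d a k * f (+ r ℤ.+ (a ℤ.- + k ℤ.* d))
    act-VU r k f a = trans (act-U^ k (act (V ^ᵀ r) f) a) (*-congˡ (act-V^ r f _))

    -- Evaluation at x = 1. Forgetting the exponent loses nothing here: every monomial of the
    -- expansion sends x ^ a to a multiple of the same power, with exponent a + ∣r∣ - ∣s∣ d.
    one : ℤ → Carrier
    one _ = 1#

    act-H : ∀ {n} (rs ss : Vec ℕ n) a → act (H rs ss) one a ≈ h ^ Vec.sum ss * orbit adm d rs ss a
    act-H []       []       a = refl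
    act-H (r ∷ rs) (t ∷ ss) a = begin
      act (V ^ᵀ r ⊗ U ^ᵀ t) (act (H rs ss) one) a
        ≈⟨ act-VU r t (act (H rs ss) one) a ⟩
      h ^ t * x * act (H rs ss) one b
        ≈⟨ *-congˡ (act-H rs ss b) ⟩
      h ^ t * x * (h ^ Vec.sum ss * orbit adm d rs ss b)
        ≈⟨ solve 4 (λ a b x y → a :* x :* (b :* y) := a :* b :* (x :* y)) refl _ _ _ _ ⟩
      h ^ t * h ^ Vec.sum ss * (x * orbit adm d rs ss b)
        ≈⟨ *-congʳ (^-homo-* h t (Vec.sum ss)) ⟨
      h ^ (t ℕ.+ Vec.sum ss) * (x * orbit adm d rs ss b) ∎
      where
      x = descending adm d a t
      b = + r ℤ.+ (a ℤ.- + t ℤ.* d)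

    -- For a negative exponent `monomial` is zero, so the coefficient must vanish for the right-hand
    -- side to agree; this keeps the formula uniform in k.
    act-monomial : ∀ e k x → (e ℤ.< 0ℤ → x ≈ 0#) → ∀ a →
                   act (ι x ⊗ monomial e k) one a ≈ x * h ^ k * descending adm d a k
    act-monomial (+ i) k x _ a = trans (act-VU i k (act (ι x) one) a)
      (solve 3 (λ x y z → y :* z :* (x :* con 1) := x :* y :* z) refl x (h ^ k) (descending adm d a k))
    act-monomial -[1+ i ] k x x≈0 a = trans (zeroˡ _)
      (sym (trans (*-congʳ (trans (*-congʳ (x≈0 ℤ.-<+)) (zeroˡ _))) (zeroˡ _)))

    act-sumᵀ : ∀ n (x : Fin n → Term) f a → act (sumᵀ {n} x) f a ≈ ∑[ i < n ] act (x i) f a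
    act-sumᵀ zero    x f a = zeroˡ _
    act-sumᵀ (suc n) x f a = +-congˡ (act-sumᵀ n (λ i → x (suc i)) f a)

-- Comparing coefficients and solving for them.

module Expansion {c ℓ₁ ℓ₂} (K : HeytingField c ℓ₁ ℓ₂) where
  open HeytingField K hiding (zero)
  open OverField K
  open Field K
  open CommutativeRing commutativeRing using (semiring; commutativeSemiring)
  open Sum semiring using (sum-cong-≋)
  open SemiringSolver commutativeSemiring using (solve; _:=_; _:*_)
  open SetoidReasoning setoid

  xz≈y⇒x≈y*inv : ∀ {x y z} (z#0 : z # 0#) → x * z ≈ y → x ≈ y * inv z#0
  xz≈y⇒x≈y*inv {x} {y} {z} z#0 xz≈y = begin
    x                  ≈⟨ *-identityʳ x ⟨
    x * 1#             ≈⟨ *-congˡ (inv-inverseʳ z#0) ⟨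
    x * (z * inv z#0)  ≈⟨ *-assoc _ _ _ ⟨
    x * z * inv z#0    ≈⟨ *-congʳ xz≈y ⟩
    y * inv z#0        ∎

  -- Meant for z = h ^ k, y = h ^ ∣s∣, w = h ^ (∣s∣ - k) and f = [k]!. As ∣s∣ - k may be negative, w
  -- enters through w z = y.
  divide : ∀ {x y z w f u} (z#0 : z # 0#) (f#0 : f # 0#) →
    w * z ≈ y → y * u ≈ x * z * f → x ≈ w * inv f#0 * u
  divide {x} {y} {z} {w} {f} {u} z#0 f#0 wz≈y yu≈xzf = begin
    x
      ≈⟨ xz≈y⇒x≈y*inv z#0 (xz≈y⇒x≈y*inv f#0 (sym yu≈xzf)) ⟩
    y * u * inv f#0 * inv z#0
      ≈⟨ solve 4 (λ y u f z → y :* u :* f :* z := y :* z :* f :* u) refl y u (inv f#0) (inv z#0) ⟩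
    y * inv z#0 * inv f#0 * u
      ≈⟨ *-congʳ (*-congʳ (xz≈y⇒x≈y*inv z#0 wz≈y)) ⟨
    w * inv f#0 * u ∎

  weight≈gaussian : (char0 : CharacteristicZero) → ∀ {p} (adm : Admissible p) k (j : Fin (suc k)) →
    Inversion.weight commutativeRing p k (toℕ j) ≈
    (- 1#) ^ (k ∸ toℕ j) * p ^ ((k ∸ toℕ j) C 2) * gaussian char0 adm k j
  weight≈gaussian char0 {p} adm k j = trans (xz≈y⇒x≈y*inv _
    (weight-closed N (factorial adm 1ℤ) N-+ refl F-suc k (toℕ j) (k ∸ toℕ j)
      -- Since j ≤ k, the truncated difference k ∸ j is the true one.
      (≡.sym (ℕ.m+[n∸m]≡n (ℕ.s≤s⁻¹ (toℕ<n j))))))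
    (*-assoc _ _ _)
    where
    open Inversion commutativeRing p
    N : ℕ → Carrier
    N n = qNumber adm (+ n)
    N-+ : ∀ a b → N (a ℕ.+ b) ≈ N a + p ^ a * N b
    N-+ a b = qNumber-+ adm (+ a) (+ b)
    F-suc : ∀ n → factorial adm 1ℤ (suc n) ≈ N (suc n) * factorial adm 1ℤ n
    F-suc n = trans (factorial-suc adm 1ℤ n)
      (*-congʳ (reflexive (≡.cong (qNumber adm) (ℤ.*-identityʳ (+ suc n)))))

  -- Here the base is p = q ^ d, so the power p ^ C(k - j, 2) has to be rewritten as a power of q
  -- with exponent C(k - j, 2) d.
  weight≈gaussian-pow : (char0 : CharacteristicZero) →
    ∀ {q} (adm : Admissible q) d .{{_ : ℤ.NonZero d}} k (j : Fin (suc k)) →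
    Inversion.weight commutativeRing (pow q (proj₁ adm) d) k (toℕ j) ≈
    (- 1#) ^ (k ∸ toℕ j) * pow q (proj₁ adm) (+ ((k ∸ toℕ j) C 2) ℤ.* d) *
    gaussian char0 (pow-admissible adm d) k j
  weight≈gaussian-pow char0 adm d k j = trans (weight≈gaussian char0 (pow-admissible adm d) k j)
    (*-congʳ {gaussian char0 (pow-admissible adm d) k j}
      (*-congˡ (sym (pow-* (proj₁ adm) ((k ∸ toℕ j) C 2) d))))

  difference≈sum : ∀ p k (f : ℕ → Carrier) (t : Fin (suc k) → Carrier) →
    (∀ j → Inversion.weight commutativeRing p k (toℕ j) ≈ t j) →
    Inversion.difference commutativeRing p k f ≈ ∑[ j < suc k ] (t j * f (toℕ j))
  difference≈sum p k f t weight≈t = sum-cong-≋ {suc k} λ j → *-congʳ {f (toℕ j)} (weight≈t j)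

  module _ {q} (adm : Admissible q) (s : ℕ) .{{_ : ℤ.NonZero (1- s)}} (h : Carrier)
           {n} (rs ss : Vec ℕ (suc n)) (S : ℕ → Carrier)
           (normal : Algebra.IsNormalOrdering s h q rs ss S) where
    open Algebra.IsNormalOrdering normal
    open Algebra s h q
    open Representation adm s h
    open Inversion commutativeRing (pow q (proj₁ adm) d)

    private
      s₁ m : ℕ
      s₁ = Vec.head ss
      m = suc (Vec.sum ss ∸ s₁)

      φ : ℕ → ℕ → Carrier
      φ i j = descending adm d (+ j ℤ.* d) i

    Ω-expansion : ∀ j → h ^ Vec.sum ss * Ω adm s rs ss j ≈
      ∑[ i < m ] (S (s₁ ℕ.+ toℕ i) * h ^ (s₁ ℕ.+ toℕ i) * φ (s₁ ℕ.+ toℕ i) j)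
    Ω-expansion j = begin
      h ^ Vec.sum ss * Ω adm s rs ss j
        ≈⟨ *-congˡ (Ω≈orbit adm s rs ss j) ⟩
      h ^ Vec.sum ss * orbit adm d rs ss (+ j ℤ.* d)
        ≈⟨ act-H rs ss (+ j ℤ.* d) ⟨
      act (H rs ss) one (+ j ℤ.* d)
        ≈⟨ act-sound expansion one (+ j ℤ.* d) ⟩
      act (sumᵀ {m} x) one (+ j ℤ.* d)
        ≈⟨ act-sumᵀ m x one (+ j ℤ.* d) ⟩
      ∑[ i < m ] act (x i) one (+ j ℤ.* d)
        ≈⟨ sum-cong-≋ {m} (λ i → act-monomial (exponentV s rs ss (s₁ ℕ.+ toℕ i)) (s₁ ℕ.+ toℕ i) (S (s₁ ℕ.+ toℕ i))
             (zero-negative (s₁ ℕ.+ toℕ i)) (+ j ℤ.* d)) ⟩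
      ∑[ i < m ] (S (s₁ ℕ.+ toℕ i) * h ^ (s₁ ℕ.+ toℕ i) * φ (s₁ ℕ.+ toℕ i) j) ∎
      where
      x : Fin m → Term
      x i = ι (S (s₁ ℕ.+ toℕ i)) ⊗ monomial (exponentV s rs ss (s₁ ℕ.+ toℕ i)) (s₁ ℕ.+ toℕ i)

    coefficient : ∀ k → h ^ Vec.sum ss * difference k (Ω adm s rs ss) ≈ S k * h ^ k * factorial adm d k
    coefficient k = begin
      h ^ Vec.sum ss * difference k (Ω adm s rs ss)
        ≈⟨ difference-* k (h ^ Vec.sum ss) (Ω adm s rs ss) ⟨
      difference k (λ j → h ^ Vec.sum ss * Ω adm s rs ss j)
        ≈⟨ difference-cong k {λ j → h ^ Vec.sum ss * Ω adm s rs ss j}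
             {λ j → ∑[ i < m ] (a (s₁ ℕ.+ toℕ i) * φ (s₁ ℕ.+ toℕ i) j)}
             Ω-expansion ⟩
      difference k (λ j → ∑[ i < m ] (a (s₁ ℕ.+ toℕ i) * φ (s₁ ℕ.+ toℕ i) j))
        ≈⟨ difference-sum k m (λ i j → a (s₁ ℕ.+ i) * φ (s₁ ℕ.+ i) j) ⟩
      ∑[ i < m ] difference k (λ j → a (s₁ ℕ.+ toℕ i) * φ (s₁ ℕ.+ toℕ i) j)
        ≈⟨ sum-cong-≋ {m} (λ i → difference-* k (a (s₁ ℕ.+ toℕ i)) (φ (s₁ ℕ.+ toℕ i))) ⟩
      ∑[ i < m ] g (s₁ ℕ.+ toℕ i)
        ≈⟨ select ⟩
      g k
        ≈⟨ *-congˡ (difference-on φ x (λ j → refl) (descending-zero adm d) (descending-pascal adm d)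
             (factorial adm d) refl (factorial-suc adm d) k) ⟩
      S k * h ^ k * factorial adm d k ∎
      where
      x : ℕ → Carrier
      x i = qNumber adm (+ i ℤ.* d)

      a : ℕ → Carrier
      a i = S i * h ^ i

      g : ℕ → Carrier
      g i = a i * difference k (φ i)

      off : ∀ i → k ≢ i → g i ≈ 0#
      off i k≢i = trans (*-congˡ (difference-off φ x (λ j → refl) (descending-zero adm d)
        (descending-pascal adm d) k i k≢i)) (zeroʳ _)

      vanish : S k ≈ 0# → g k ≈ 0#
      vanish Sk≈0 = trans (*-congʳ (trans (*-congʳ Sk≈0) (zeroˡ _))) (zeroˡ _)

      select : ∑[ i < m ] g (s₁ ℕ.+ toℕ i) ≈ g k
      -- The sum starts at s₁. If k < s₁, no index equals k and S k = 0. Otherwise k sits at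
      -- position k - s₁; for k > ∣s∣ this is past the end of the sum, and S k = 0 again.
      select with s₁ ℕ.≤? k
      ... | no s₁≰k = trans
        (sum-zero m (λ i → g (s₁ ℕ.+ i)) λ i → off (s₁ ℕ.+ i) λ k≡s₁+i →
          s₁≰k (≡.subst (s₁ ℕ.≤_) (≡.sym k≡s₁+i) (ℕ.m≤m+n s₁ i)))
        (sym (vanish (zero-below k (ℕ.≰⇒> s₁≰k))))
      ... | yes s₁≤k = trans
        (sum-single m (λ i → g (s₁ ℕ.+ i)) (k ∸ s₁)
          (λ i i≢k-s₁ → off (s₁ ℕ.+ i) λ k≡s₁+i →
            i≢k-s₁ (≡.sym (≡.trans (≡.cong (_∸ s₁) k≡s₁+i) (ℕ.m+n∸m≡n s₁ i))))
          (λ m≤k-s₁ → trans g[k]≈ (vanish (zero-above k (ℕ.≰⇒> λ k≤∣ss∣ →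
            ℕ.<⇒≱ m≤k-s₁ (ℕ.∸-monoˡ-≤ s₁ k≤∣ss∣))))))
        g[k]≈
        where
        g[k]≈ : g (s₁ ℕ.+ (k ∸ s₁)) ≈ g k
        g[k]≈ = reflexive (≡.cong g (ℕ.m+[n∸m]≡n s₁≤k))

    coefficient-formula : (char0 : CharacteristicZero) (h#0 : h # 0#) → ∀ k → S k ≈
      pow h h#0 (+ Vec.sum ss ℤ.- + k) *
      inv {factorial adm (1- s) k} (factorial#0 char0 adm (1- s) k) *
      difference k (Ω adm s rs ss)
    coefficient-formula char0 h#0 k =
      divide (^#0 k h#0) (factorial#0 char0 adm (1- s) k) hᵏ (coefficient k)
      where
      cancel : ∀ i j → i ℤ.- j ℤ.+ j ≡ i
      cancel = solve-∀
      hᵏ : pow h h#0 (+ Vec.sum ss ℤ.- + k) * h ^ k ≈ h ^ Vec.sum ss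
      hᵏ = trans (sym (pow-+ h#0 (+ Vec.sum ss ℤ.- + k) (+ k)))
        (reflexive (≡.cong (pow h h#0) (cancel (+ Vec.sum ss) (+ k))))

theorem12 : ∀ {c ℓ₁ ℓ₂} (K : HeytingField c ℓ₁ ℓ₂) →
    let open HeytingField K
        open OverField K
    in
    (char0 : CharacteristicZero)
    (s : ℕ) (s≢1 : s ≢ 1)
    (h : Carrier) (h#0 : h # 0#)
    (q : Carrier) (q#0 : q # 0#) (q-cond : q ≈ 1# ⊎ NotRootOfUnity q)
    (n : ℕ) (rs ss : Vec ℕ (suc n))
    (S : ℕ → Carrier) → Algebra.IsNormalOrdering s h q rs ss S →
    let instance _ = ℤ.≢-nonZero (1-s≢0 s≢1)
        adm = (q#0 , q-cond)
    in
    ∀ k → S k ≈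
      pow h h#0 (+ Vec.sum ss ℤ.- + k) *
      inv {factorial adm (1- s) k} (factorial#0 char0 adm (1- s) k) *
      ∑[ j < suc k ]
        ((- 1#) ^ (k ∸ toℕ j) * pow q q#0 (+ ((k ∸ toℕ j) C 2) ℤ.* (1- s)) *
         gaussian char0 (pow-admissible adm (1- s)) k j * Ω adm s rs ss (toℕ j))
theorem12 K char0 s s≢1 h h#0 q q#0 q-cond n rs ss S normal k =
  trans (coefficient-formula adm s h rs ss S normal char0 h#0 k)
    (*-congˡ (difference≈sum (pow q q#0 (1- s)) k (Ω adm s rs ss)
      (λ j → (- 1#) ^ (k ∸ toℕ j) * pow q q#0 (+ ((k ∸ toℕ j) C 2) ℤ.* (1- s)) *
             gaussian char0 (pow-admissible adm (1- s)) k j)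
      (weight≈gaussian-pow char0 adm (1- s) k)))
  where
  open HeytingField K
  open OverField K
  open Field K
  open Expansion K
  instance _ = ℤ.≢-nonZero (1-s≢0 s≢1)
  adm : Admissible q
  adm = (q#0 , q-cond)
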